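{- Let $c, d \in \mathbb{Z}$ with $d \ge 2$, let $\phi(x) = x^d + c$, and let $D_{d,c} = \{n \in \mathbb{Z} : n \ge 1,\ n \mid \phi^n(0)\}$. The set $D_{d,c}$ is finite if and only if either (1) $d$ is even and $c = 1$, or (2) $d = 2$ and $c = -2$. Moreover, if $D_{d,c}$ is finite, then $D_{d,c} = \{1,2\}$.
   Context: Here $\phi^n$ denotes the $n$-th iterate of $\phi$. -}

module Defs where

open import Data.Integer using (ℤ; +_; 0ℤ; _+_; _^_)
open import Data.Integer.Divisibility using (_∣_)
open import Data.List.Membership.Propositional using (_∈_)
open import Data.Nat using (ℕ; _≤_)
open import Data.Nat.GeneralisedArithmetic using (iterate)
open import Data.Product using (_×_; ∃-syntax)
open import Level using (Level; 0ℓ; _⊔_)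
open import Relation.Unary using (Pred; _≐_)

φ : ℕ → ℤ → ℤ → ℤ
φ d c x = x ^ d + c

-- A set of integers n ≥ 1 is represented as a predicate on ℕ, so that its
-- elements can serve directly as iteration counts.
D : ℕ → ℤ → Pred ℕ 0ℓ
D d c n = 1 ≤ n × (+ n) ∣ iterate (φ d c) 0ℤ n

-- The list may contain repetitions.
Finite : ∀ {a ℓ : Level} {A : Set a} → Pred A ℓ → Set (a ⊔ ℓ)
Finite P = ∃[ xs ] P ≐ (λ x → x ∈ xs)

-- Write W n = φⁿ(0).  Since φ respects congruences, k ∣ n implies W k ∣ W n; hence n ∈ D implies
-- ∣W n∣ ∈ D (when W n ≠ 0).  D is therefore unbounded as soon as it contains an n from which on
-- ∣W n∣ > n, and this holds with n = 1 if ∣c∣ ≥ 2 (unless x² - 2), and with n = 3 if c = ±1 and d is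
-- odd, because then W 3 = φ(2c) ≡ φ(-c) = 0 modulo 3.  In the other cases outside (1) and (2),
-- 0 is periodic.
--
-- For d even and c = 1 the orbit is 1, 2, 1, 2, … modulo 4, so no n ∈ D is divisible by 4.  Suppose
-- an odd p = 2h + 1 > 1 divides n ∈ D.  As φ(x) depends only on x², two of W 0, …, W (h + 1) have
-- the same image modulo p, and since 0 is periodic modulo p this gives p ∣ W t for some
-- 1 ≤ t ≤ h + 1 < p.  Then p ∣ W (gcd t n), and the odd part of gcd t n is a smaller odd divisor of
-- n; by descent it is 1, so p divides W 1 = 1 or W 2 = 2, a contradiction.

module Submission where

open import Defs
open import Data.Integer using (ℤ; -_; +_; -[1+_]; 0ℤ; 1ℤ; ∣_∣; _+_; _-_; _*_; _^_)
open import Data.Integer.DivMod using (_%ℕ_; _/ℕ_; a≡a%ℕn+[a/ℕn]*n; n%ℕd<d)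
open import Data.Integer.Divisibility.Signed as ℤ∣ using (divides; ∣ᵤ⇒∣; ∣⇒∣ᵤ)
import Data.Integer.Properties as ℤ
open import Data.Integer.Tactic.RingSolver using (solve-∀)
open import Data.Nat as ℕ using (ℕ; zero; suc; _≤_; _<_; z≤n; s≤s; z<s; _∸_)
open import Data.Nat.Divisibility using (_∣_)
open import Data.Product using (_×_; _,_; proj₁; proj₂; ∃-syntax)
open import Data.Sum using (_⊎_; inj₁; inj₂)
open import Function.Bundles using (_⇔_; mk⇔)
open import Relation.Binary.PropositionalEquality
  using (_≡_; refl; sym; trans; cong; subst; module ≡-Reasoning)
open import Level using (0ℓ)
open import Relation.Nullary using (¬_; contradiction)
open import Relation.Unary using (Pred; _⊆_; _≐_; _∪_; ｛_｝)
open import Data.Fin using (Fin; toℕ; fromℕ<)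
import Data.Fin.Properties as Fin
open import Data.List using (_∷_; [])
open import Data.List.Extrema.Nat using (max; xs≤max)
open import Data.List.Membership.Propositional using (_∈_)
import Data.List.Relation.Unary.All as All
open import Data.List.Relation.Unary.Any using (here; there)
open import Data.Nat.GeneralisedArithmetic using (iterate)
open import Data.Nat.GCD using (module GCD; module Bézout)
open import Data.Nat.Induction using (<-rec)
import Data.Nat.Divisibility as ℕ∣
import Data.Nat.Properties as ℕ
import Data.Nat.Tactic.RingSolver as ℕ-Solver

-- Congruences of integers

infix 4 _≡_[mod_]

-- A record rather than a synonym for divisibility of `a - b`, so that `a`, `b` and `m` can be
-- inferred: subtraction unfolds and would not determine its operands.
record _≡_[mod_] (a b m : ℤ) : Set where
  constructor mod
  field ∣difference : m ℤ∣.∣ a - b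

private
  variable
    a b m x y : ℤ

-- Abstract because the with-abstractions below would otherwise normalise these proofs,
-- including the output of the ring solver.
abstract
  mod-refl : a ≡ a [mod m ]
  mod-refl {a} = mod (divides 0ℤ (ℤ.+-inverseʳ a))

  mod-reflexive : a ≡ b → a ≡ b [mod m ]
  mod-reflexive refl = mod-refl

  mod-trans : a ≡ b [mod m ] → b ≡ x [mod m ] → a ≡ x [mod m ]
  mod-trans {a} {b} {m} {x} (mod p) (mod q) =
    mod (subst (m ℤ∣.∣_) (telescope a b x) (ℤ∣.∣m∣n⇒∣m+n p q))
    where
    telescope : ∀ a b x → (a - b) + (b - x) ≡ a - x
    telescope = solve-∀

  mod-sym : a ≡ b [mod m ] → b ≡ a [mod m ]
  mod-sym {a} {b} {m} (mod p) = mod (subst (m ℤ∣.∣_) (negate a b) (ℤ∣.∣m⇒∣-m p))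
    where
    negate : ∀ a b → - (a - b) ≡ b - a
    negate = solve-∀

  +-mod : a ≡ b [mod m ] → x ≡ y [mod m ] → a + x ≡ b + y [mod m ]
  +-mod {a} {b} {m} {x} {y} (mod p) (mod q) =
    mod (subst (m ℤ∣.∣_) (regroup a b x y) (ℤ∣.∣m∣n⇒∣m+n p q))
    where
    regroup : ∀ a b x y → (a - b) + (x - y) ≡ (a + x) - (b + y)
    regroup = solve-∀

  *-mod : a ≡ b [mod m ] → x ≡ y [mod m ] → a * x ≡ b * y [mod m ]
  *-mod {a} {b} {m} {x} {y} (mod p) (mod q) =
    mod (subst (m ℤ∣.∣_) (regroup a b x y)
      (ℤ∣.∣m∣n⇒∣m+n (ℤ∣.∣m⇒∣m*n x p) (ℤ∣.∣n⇒∣m*n b q)))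
    where
    regroup : ∀ a b x y → (a - b) * x + b * (x - y) ≡ a * x - b * y
    regroup = solve-∀

  ^-mod : ∀ k → a ≡ b [mod m ] → a ^ k ≡ b ^ k [mod m ]
  ^-mod zero    p = mod-refl
  ^-mod (suc k) p = *-mod p (^-mod k p)

  ∣⇒mod : m ℤ∣.∣ a → a ≡ 0ℤ [mod m ]
  ∣⇒mod {m} {a} p = mod (subst (m ℤ∣.∣_) (sym (ℤ.+-identityʳ a)) p)

  mod⇒∣ : a ≡ 0ℤ [mod m ] → m ℤ∣.∣ a
  mod⇒∣ {a} {m} (mod p) = subst (m ℤ∣.∣_) (ℤ.+-identityʳ a) p

  mod-∣ : ∀ {k n} → k ∣ n → x ≡ y [mod + n ] → x ≡ y [mod + k ]
  mod-∣ k∣n (mod p) = mod (ℤ∣.∣-trans (∣ᵤ⇒∣ k∣n) p)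

  φ-mod : ∀ d c → a ≡ b [mod m ] → φ d c a ≡ φ d c b [mod m ]
  φ-mod d c p = +-mod (^-mod d p) mod-refl

-- The orbit of 0 and its zeros modulo `m`

iterate-+ : ∀ {A : Set} (f : A → A) z k l →
            iterate f z (k ℕ.+ l) ≡ iterate f (iterate f z k) l
iterate-+ f z zero    l = refl
iterate-+ f z (suc k) l = iterate-+ f (f z) k l

iterate-suc : ∀ {A : Set} (f : A → A) z k → iterate f z (suc k) ≡ f (iterate f z k)
iterate-suc f z zero    = refl
iterate-suc f z (suc k) = iterate-suc f (f z) k

orbit : ℕ → ℤ → ℕ → ℤ
orbit d c = iterate (φ d c) 0ℤ

module _ (d : ℕ) (c : ℤ) where

  iterate-mod : ∀ k → a ≡ b [mod m ] →
                iterate (φ d c) a k ≡ iterate (φ d c) b k [mod m ]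
  iterate-mod zero    p = p
  iterate-mod (suc k) p = iterate-mod k (φ-mod d c p)

  orbit-+-mod : ∀ k l → orbit d c k ≡ 0ℤ [mod m ] →
                orbit d c (k ℕ.+ l) ≡ orbit d c l [mod m ]
  orbit-+-mod k l p =
    mod-trans (mod-reflexive (iterate-+ (φ d c) 0ℤ k l)) (iterate-mod l p)

  orbit-* : ∀ k n → orbit d c n ≡ 0ℤ [mod m ] → orbit d c (k ℕ.* n) ≡ 0ℤ [mod m ]
  orbit-* zero    n p = mod-refl
  orbit-* (suc k) n p = mod-trans (orbit-+-mod n (k ℕ.* n) p) (orbit-* k n p)

  orbit-∣ : ∀ {k n} → k ∣ n → orbit d c k ≡ 0ℤ [mod m ] → orbit d c n ≡ 0ℤ [mod m ]
  orbit-∣ {k = k} (ℕ∣.divides q refl) = orbit-* q k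

  -- Multiples of `k` and `n` are again zeros modulo `m`. Hence adding `y * n` to the index `g`
  -- keeps the value, and the sum is the zero `x * k`. The relation is a Bézout identity without
  -- subtraction.
  orbit-bézout : ∀ {g k} x y n → orbit d c k ≡ 0ℤ [mod m ] → orbit d c n ≡ 0ℤ [mod m ] →
                 g ℕ.+ y ℕ.* n ≡ x ℕ.* k → orbit d c g ≡ 0ℤ [mod m ]
  orbit-bézout {g = g} {k} x y n p q eq =
    mod-trans (mod-sym (orbit-+-mod (y ℕ.* n) g (orbit-* y n q)))
      (mod-trans (mod-reflexive (cong (orbit d c) (trans (ℕ.+-comm (y ℕ.* n) g) eq)))
        (orbit-* x k p))

  abstract
    -- Bézout gives a zero at the gcd of `k` and `n`. Only its two divisibilities are recorded: the
    -- descent needs a divisor of `n` that is bounded through `k`.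
    orbit-common-divisor : ∀ k n → orbit d c k ≡ 0ℤ [mod m ] → orbit d c n ≡ 0ℤ [mod m ] →
                           ∃[ g ] (g ∣ k) × (g ∣ n) × orbit d c g ≡ 0ℤ [mod m ]
    orbit-common-divisor {m} k n p q = from (Bézout.lemma k n)
      where
      from : Bézout.Lemma k n → ∃[ g ] (g ∣ k) × (g ∣ n) × orbit d c g ≡ 0ℤ [mod m ]
      from (Bézout.result g isGCD identity) =
        g , proj₁ (GCD.commonDivisor isGCD) , proj₂ (GCD.commonDivisor isGCD) , Wg≡0 identity
        where
        Wg≡0 : Bézout.Identity g k n → orbit d c g ≡ 0ℤ [mod m ]
        Wg≡0 (Bézout.+- x y eq) = orbit-bézout x y n p q eq
        Wg≡0 (Bézout.-+ x y eq) = orbit-bézout y x k q p eq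

  D⇒mod : ∀ {n} → D d c n → orbit d c n ≡ 0ℤ [mod + n ]
  D⇒mod (_ , n∣W) = ∣⇒mod (∣ᵤ⇒∣ n∣W)

  mod⇒D : ∀ {n} → 1 ≤ n → orbit d c n ≡ 0ℤ [mod + n ] → D d c n
  mod⇒D 1≤n p = 1≤n , ∣⇒∣ᵤ (mod⇒∣ p)

  D-orbit : ∀ {n} → 1 ≤ ∣ orbit d c n ∣ → D d c n → D d c ∣ orbit d c n ∣
  D-orbit 1≤W (_ , n∣W) =
    mod⇒D 1≤W (orbit-∣ n∣W (∣⇒mod (ℤ∣.∣m∣∣m)))

  1∈D : D d c 1
  1∈D = s≤s z≤n , ℕ∣.1∣ _

-- Criteria for `D` to be infinite

unbounded⇒¬Finite : ∀ {P Q : Pred ℕ 0ℓ} {n₀} → Q ⊆ P → Q n₀ →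
                    (∀ {n} → Q n → ∃[ k ] n < k × Q k) → ¬ Finite P
unbounded⇒¬Finite {P} {Q} {n₀} Q⊆P Qn₀ step (xs , P⊆xs , _) =
  let k , max<k , Qk = beyond (suc (max 0 xs)) in
  ℕ.<⇒≱ max<k (All.lookup (xs≤max 0 xs) (P⊆xs (Q⊆P Qk)))
  where
  -- Each use of `step` gains at least 1, so `N` uses from `n₀` reach `N`; one more than the maximum
  -- of the list is enough to leave it.
  beyond : ∀ N → ∃[ k ] N ≤ k × Q k
  beyond zero    = n₀ , z≤n , Qn₀
  beyond (suc N) =
    let k , N≤k , Qk = beyond N
        l , k<l , Ql = step Qk
    in l , ℕ.≤-<-trans N≤k k<l , Ql

-- The zero recurs at every multiple of `suc r`, and 0 is divisible by every index.
orbit-returns⇒infinite : ∀ d c r → orbit d c (suc r) ≡ 0ℤ → ¬ Finite (D d c)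
orbit-returns⇒infinite d c r W≡0 =
  unbounded⇒¬Finite {Q = λ n → 1 ≤ n × suc r ∣ n}
    (λ (1≤n , r∣n) → mod⇒D d c 1≤n (orbit-∣ d c r∣n (mod-reflexive W≡0)))
    (s≤s z≤n , ℕ∣.∣-refl)
    (λ {n} (_ , r∣n) → suc r ℕ.+ n , ℕ.m<n+m n z<s
      , s≤s z≤n , ℕ∣.∣m∣n⇒∣m+n ℕ∣.∣-refl r∣n)

-- Growth of the orbit

Expanding : ℕ → ℤ → Set
Expanding d c = ∀ x → 2 ≤ ∣ x ∣ → ∣ c ∣ ≤ ∣ x ∣ → 2 ℕ.* ∣ x ∣ ≤ ∣ φ d c x ∣

1+k≤2*k : ∀ {k} → 1 ≤ k → suc k ≤ 2 ℕ.* k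
1+k≤2*k {k} 1≤k = subst (suc k ≤_) (cong (k ℕ.+_) (sym (ℕ.+-identityʳ k))) (ℕ.+-monoˡ-≤ k 1≤k)

module _ {d c} (exp : Expanding d c) where

  escape : ∀ x k → 2 ≤ ∣ x ∣ → ∣ c ∣ ≤ ∣ x ∣ → ∣ x ∣ ℕ.+ k ≤ ∣ iterate (φ d c) x k ∣
  escape x zero _ _ = ℕ.≤-reflexive (ℕ.+-identityʳ _)
  escape x (suc k) 2≤x c≤x = begin
    ∣ x ∣ ℕ.+ suc k                 ≡⟨ ℕ.+-suc ∣ x ∣ k ⟩
    suc ∣ x ∣ ℕ.+ k                 ≤⟨ ℕ.+-monoˡ-≤ k x<φx ⟩
    ∣ φ d c x ∣ ℕ.+ k               ≤⟨ escape (φ d c x) k (ℕ.≤-trans 2≤x (ℕ.<⇒≤ x<φx)) (ℕ.≤-trans c≤x (ℕ.<⇒≤ x<φx)) ⟩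
    ∣ iterate (φ d c) (φ d c x) k ∣ ∎
    where
    open ℕ.≤-Reasoning
    x<φx : ∣ x ∣ < ∣ φ d c x ∣
    x<φx = ℕ.≤-trans (1+k≤2*k (ℕ.<⇒≤ 2≤x)) (exp x 2≤x c≤x)

  -- By `escape`, the lower bound for `∣ W n ∣` rises by 1 per step from `n₀` on, as the index does,
  -- so `∣ W n ∣` stays above `n`. For `n` in this tail of `D`, `∣ W n ∣` is therefore a larger
  -- element of the same tail.
  escape⇒infinite : ∀ n₀ → D d c n₀ → 2 ≤ ∣ orbit d c n₀ ∣ → ∣ c ∣ ≤ ∣ orbit d c n₀ ∣ →
                    n₀ < ∣ orbit d c n₀ ∣ → ¬ Finite (D d c)
  escape⇒infinite n₀ n₀∈D 2≤W c≤W n₀<W =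
    unbounded⇒¬Finite {Q = λ n → n₀ ≤ n × D d c n} proj₂ (ℕ.≤-refl , n₀∈D) step
    where
    open ℕ.≤-Reasoning
    n<W : ∀ {n} → n₀ ≤ n → n < ∣ orbit d c n ∣
    n<W n₀≤n with k , refl ← ℕ.m≤n⇒∃[o]m+o≡n n₀≤n = begin-strict
      n₀ ℕ.+ k                                <⟨ ℕ.+-monoˡ-< k n₀<W ⟩
      ∣ orbit d c n₀ ∣ ℕ.+ k                  ≤⟨ escape (orbit d c n₀) k 2≤W c≤W ⟩
      ∣ iterate (φ d c) (orbit d c n₀) k ∣    ≡⟨ cong ∣_∣ (iterate-+ (φ d c) 0ℤ n₀ k) ⟨
      ∣ orbit d c (n₀ ℕ.+ k) ∣                ∎
    step : ∀ {n} → n₀ ≤ n × D d c n → ∃[ k ] n < k × n₀ ≤ k × D d c k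
    step {n} (n₀≤n , n∈D) =
      ∣ orbit d c n ∣ , n<W n₀≤n , ℕ.≤-trans n₀≤n (ℕ.<⇒≤ (n<W n₀≤n))
      , D-orbit d c (ℕ.≤-trans (s≤s z≤n) (n<W n₀≤n)) n∈D

abs-^ : ∀ x k → ∣ x ^ k ∣ ≡ ∣ x ∣ ℕ.^ k
abs-^ x zero    = refl
abs-^ x (suc k) = trans (ℤ.abs-* x (x ^ k)) (cong (∣ x ∣ ℕ.*_) (abs-^ x k))

-- Adding `c` costs at most `∣ x ∣`, so of three copies of `∣ x ∣` two remain.
triple⇒double : ∀ d c x → ∣ c ∣ ≤ ∣ x ∣ → 3 ℕ.* ∣ x ∣ ≤ ∣ x ∣ ℕ.^ d → 2 ℕ.* ∣ x ∣ ≤ ∣ φ d c x ∣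
triple⇒double d c x c≤x 3x≤x^d = ℕ.+-cancelˡ-≤ (∣ x ∣) _ _ (begin
  3 ℕ.* ∣ x ∣               ≤⟨ 3x≤x^d ⟩
  ∣ x ∣ ℕ.^ d               ≡⟨ abs-^ x d ⟨
  ∣ x ^ d ∣                 ≡⟨ cong ∣_∣ (cancel (x ^ d) c) ⟩
  ∣ - c + φ d c x ∣         ≤⟨ ℤ.∣i+j∣≤∣i∣+∣j∣ (- c) (φ d c x) ⟩
  ∣ - c ∣ ℕ.+ ∣ φ d c x ∣   ≡⟨ cong (ℕ._+ ∣ φ d c x ∣) (ℤ.∣-i∣≡∣i∣ c) ⟩
  ∣ c ∣ ℕ.+ ∣ φ d c x ∣     ≤⟨ ℕ.+-monoˡ-≤ (∣ φ d c x ∣) c≤x ⟩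
  ∣ x ∣ ℕ.+ ∣ φ d c x ∣     ∎)
  where
  open ℕ.≤-Reasoning
  cancel : ∀ y c → y ≡ - c + (y + c)
  cancel = solve-∀

*≤^ : ∀ k n e → k ≤ n ℕ.^ e → k ℕ.* n ≤ n ℕ.^ suc e
*≤^ k n e k≤ = subst (_≤ n ℕ.^ suc e) (ℕ.*-comm n k) (ℕ.*-monoʳ-≤ n k≤)

-- The cofactor of `∣ x ∣` in `∣ x ∣ ^ d` is at least `2 ^ 2`, more than the 3 required.
expanding-degree≥3 : ∀ d c → 3 ≤ d → Expanding d c
expanding-degree≥3 (suc (suc (suc e))) c (s≤s (s≤s (s≤s _))) x 2≤x c≤x =
  triple⇒double (3 ℕ.+ e) c x c≤x (*≤^ 3 (∣ x ∣) (2 ℕ.+ e) (begin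
    3                     ≤⟨ ℕ.n≤1+n 3 ⟩
    2 ℕ.^ 2               ≤⟨ ℕ.^-monoˡ-≤ 2 2≤x ⟩
    ∣ x ∣ ℕ.^ 2           ≤⟨ ℕ.^-monoʳ-≤ ∣ x ∣ {{ℕ.>-nonZero (ℕ.<⇒≤ 2≤x)}} (s≤s (s≤s (z≤n {e}))) ⟩
    ∣ x ∣ ℕ.^ (2 ℕ.+ e)   ∎))
  where open ℕ.≤-Reasoning

-- Here `∣ x ∣ ≥ ∣ c ∣ ≥ 3`, so a single further power of `∣ x ∣` supplies the factor 3 and degree 2
-- is included.
expanding-∣c∣≥3 : ∀ d c → 2 ≤ d → 3 ≤ ∣ c ∣ → Expanding d c
expanding-∣c∣≥3 (suc (suc e)) c (s≤s (s≤s _)) 3≤c x 2≤x c≤x =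
  triple⇒double (2 ℕ.+ e) c x c≤x (*≤^ 3 (∣ x ∣) (1 ℕ.+ e) (begin
    3                     ≤⟨ ℕ.≤-trans 3≤c c≤x ⟩
    ∣ x ∣                 ≡⟨ ℕ.^-identityʳ ∣ x ∣ ⟨
    ∣ x ∣ ℕ.^ 1           ≤⟨ ℕ.^-monoʳ-≤ ∣ x ∣ {{ℕ.>-nonZero (ℕ.<⇒≤ 2≤x)}} (s≤s (z≤n {e})) ⟩
    ∣ x ∣ ℕ.^ (1 ℕ.+ e)   ∎))
  where open ℕ.≤-Reasoning

x²≡+∣x∣² : ∀ x → x ^ 2 ≡ + (∣ x ∣ ℕ.^ 2)
x²≡+∣x∣² (+ n)    = trans (cong (+ n *_) (ℤ.*-identityʳ (+ n)))
                      (trans (sym (ℤ.pos-* n n)) (cong (λ k → + (n ℕ.* k)) (sym (ℕ.*-identityʳ n))))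
x²≡+∣x∣² -[1+ n ] = trans (cong (-[1+ n ] *_) (ℤ.*-identityʳ -[1+ n ]))
                      (cong (λ k → + (suc n ℕ.* k)) (sym (ℕ.*-identityʳ (suc n))))

-- Two nonnegative terms cannot cancel, so `∣ x ∣ ≥ 2` suffices. This covers `x² + 2`, which the two
-- criteria above miss.
expanding-x²+c : ∀ n → Expanding 2 (+ n)
expanding-x²+c n x 2≤x _ = begin
  2 ℕ.* ∣ x ∣               ≤⟨ *≤^ 2 (∣ x ∣) 1 (subst (2 ≤_) (sym (ℕ.^-identityʳ ∣ x ∣)) 2≤x) ⟩
  ∣ x ∣ ℕ.^ 2               ≤⟨ ℕ.m≤m+n _ n ⟩
  ∣ + (∣ x ∣ ℕ.^ 2) + + n ∣ ≡⟨ cong (λ z → ∣ z + + n ∣) (x²≡+∣x∣² x) ⟨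
  ∣ φ 2 (+ n) x ∣           ∎
  where open ℕ.≤-Reasoning

-- Parity, and odd degree with `c = ±1`

even∨odd : ∀ n → (∃[ h ] n ≡ h ℕ.* 2) ⊎ (∃[ h ] n ≡ suc (h ℕ.* 2))
even∨odd zero = inj₁ (0 , refl)
even∨odd (suc n) with even∨odd n
... | inj₁ (h , eq) = inj₂ (h , cong suc eq)
... | inj₂ (h , eq) = inj₁ (suc h , cong suc eq)

even-^ : ∀ a q → a ^ (q ℕ.* 2) ≡ (a * a) ^ q
even-^ a q = begin
  a ^ (q ℕ.* 2)   ≡⟨ cong (a ^_) (ℕ.*-comm q 2) ⟩
  a ^ (2 ℕ.* q)   ≡⟨ ℤ.^-*-assoc a 2 q ⟨
  (a ^ 2) ^ q     ≡⟨ cong (λ z → (a * z) ^ q) (ℤ.*-identityʳ a) ⟩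
  (a * a) ^ q     ∎
  where open ≡-Reasoning

unit-^-even : ∀ a q → a * a ≡ 1ℤ → a ^ (q ℕ.* 2) ≡ 1ℤ
unit-^-even a q a²≡1 = trans (even-^ a q) (trans (cong (_^ q) a²≡1) (ℤ.^-zeroˡ q))

unit-^-odd : ∀ a q → a * a ≡ 1ℤ → a ^ suc (q ℕ.* 2) ≡ a
unit-^-odd a q a²≡1 = trans (cong (a *_) (unit-^-even a q a²≡1)) (ℤ.*-identityʳ a)

φ-zero : ∀ {d} c → 1 ≤ d → φ d c 0ℤ ≡ c
φ-zero c (s≤s {n = e} _) = trans (cong (_+ c) (ℤ.*-zeroˡ (0ℤ ^ e))) (ℤ.+-identityˡ c)

orbit-1 : ∀ d c → 1 ≤ d → orbit d c 1 ≡ c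
orbit-1 d c 1≤d = φ-zero c 1≤d

orbit-2 : ∀ d c → 1 ≤ d → orbit d c 2 ≡ φ d c c
orbit-2 d c 1≤d = cong (φ d c) (φ-zero c 1≤d)

-- The hypotheses on `c` hold by computation at both 1 and -1. The escape starts at index 3 because
-- `∣ W 1 ∣ = 1` and `∣ W 2 ∣ = 2` do not exceed their indices.
odd-unit⇒infinite : ∀ q c → 1 ≤ q → c * c ≡ 1ℤ → ∣ c ∣ ≡ 1 → ∣ c + c ∣ ≡ 2 →
                    ¬ Finite (D (suc (q ℕ.* 2)) c)
odd-unit⇒infinite q c 1≤q c²≡1 ∣c∣≡1 ∣2c∣≡2 =
  escape⇒infinite {d} {c} exp 3 3∈D (ℕ.≤-trans (ℕ.m≤n+m 2 2) 4≤W)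
    (subst (_≤ ∣ orbit d c 3 ∣) (sym ∣c∣≡1) (ℕ.≤-trans (ℕ.m≤n+m 1 3) 4≤W)) 4≤W
  where
  d = suc (q ℕ.* 2)

  exp : Expanding d c
  exp = expanding-degree≥3 d c (s≤s (ℕ.*-monoˡ-≤ 2 1≤q))

  W₃ : orbit d c 3 ≡ φ d c (c + c)
  W₃ = cong (φ d c) (trans (orbit-2 d c (s≤s z≤n)) (cong (_+ c) (unit-^-odd c q c²≡1)))

  -- Doubling `∣ W 2 ∣ = 2` gives 4, above the index 3. Strict growth alone would give only 3, hence
  -- the factor 2 in `Expanding`.
  4≤W : 4 ≤ ∣ orbit d c 3 ∣
  4≤W rewrite W₃ = subst (λ k → 2 ℕ.* k ≤ ∣ φ d c (c + c) ∣) ∣2c∣≡2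
    (exp (c + c) (ℕ.≤-reflexive (sym ∣2c∣≡2)) (subst (∣ c ∣ ≤_) (sym ∣2c∣≡2)
      (subst (_≤ 2) (sym ∣c∣≡1) (s≤s z≤n))))

  2c≡-c : c + c ≡ - c [mod + 3 ]
  2c≡-c = mod (divides c (triple c))
    where
    triple : ∀ c → (c + c) - (- c) ≡ c * + 3
    triple = solve-∀

  φ[-c]≡0 : φ d c (- c) ≡ 0ℤ
  φ[-c]≡0 = trans (cong (_+ c) (unit-^-odd (- c) q (trans (square-neg c) c²≡1))) (ℤ.+-inverseˡ c)
    where
    square-neg : ∀ c → (- c) * (- c) ≡ c * c
    square-neg = solve-∀

  3∈D : D d c 3
  3∈D = mod⇒D d c (s≤s z≤n)
    (mod-trans (mod-reflexive W₃) (mod-trans (φ-mod d c 2c≡-c) (mod-reflexive φ[-c]≡0)))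

large⇒infinite : ∀ d c → 1 ≤ d → 2 ≤ ∣ c ∣ → Expanding d c → ¬ Finite (D d c)
large⇒infinite d c 1≤d 2≤c exp =
  escape⇒infinite {d} {c} exp 1 (1∈D d c) 2≤W (ℕ.≤-reflexive (cong ∣_∣ (sym W₁))) 2≤W
  where
  W₁ = orbit-1 d c 1≤d
  2≤W : 2 ≤ ∣ orbit d c 1 ∣
  2≤W = subst (λ w → 2 ≤ ∣ w ∣) (sym W₁) 2≤c

1≤half : ∀ {q} → 2 ≤ suc (q ℕ.* 2) → 1 ≤ q
1≤half {suc q} _ = s≤s z≤n
1≤half {zero} (s≤s ())

-- Excluding all other pairs `d`, `c`

Exceptional : ℕ → ℤ → Set
Exceptional d c = (2 ∣ d × c ≡ + 1) ⊎ (d ≡ 2 × c ≡ - (+ 2))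

finite⇒exceptional : ∀ d c → 2 ≤ d → Finite (D d c) → Exceptional d c
-- Here 0 is a fixed point.
finite⇒exceptional d (+ 0) 2≤d fin =
  contradiction fin (orbit-returns⇒infinite d (+ 0) 0 (orbit-1 d (+ 0) (ℕ.<⇒≤ 2≤d)))
finite⇒exceptional d (+ 1) 2≤d fin with even∨odd d
... | inj₁ (q , d≡2q)  = inj₁ (ℕ∣.divides q d≡2q , refl)
... | inj₂ (q , refl) =
  contradiction fin (odd-unit⇒infinite q (+ 1) (1≤half 2≤d) refl refl refl)
finite⇒exceptional d -[1+ 0 ] 2≤d fin with even∨odd d
-- In even degree -1 maps back to 0, so 0 has period 2.
... | inj₁ (q , refl) = contradiction fin (orbit-returns⇒infinite d -[1+ 0 ] 1
        (trans (orbit-2 d -[1+ 0 ] (ℕ.<⇒≤ 2≤d)) (cong (_- 1ℤ) (unit-^-even -[1+ 0 ] q refl))))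
... | inj₂ (q , refl) =
  contradiction fin (odd-unit⇒infinite q -[1+ 0 ] (1≤half 2≤d) refl refl refl)
finite⇒exceptional d c@(+ suc (suc n)) 2≤d fin with ℕ.m≤n⇒m<n∨m≡n 2≤d
... | inj₁ 3≤d  = contradiction fin
  (large⇒infinite d c (ℕ.<⇒≤ 2≤d) (s≤s (s≤s z≤n)) (expanding-degree≥3 d c 3≤d))
... | inj₂ refl = contradiction fin
  (large⇒infinite d c (s≤s z≤n) (s≤s (s≤s z≤n)) (expanding-x²+c (2 ℕ.+ n)))
finite⇒exceptional d c@(-[1+ suc (suc n) ]) 2≤d fin = contradiction fin
  (large⇒infinite d c (ℕ.<⇒≤ 2≤d) (s≤s (s≤s z≤n))
    (expanding-∣c∣≥3 d c 2≤d (s≤s (s≤s (s≤s z≤n)))))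
finite⇒exceptional d c@(-[1+ 1 ]) 2≤d fin with ℕ.m≤n⇒m<n∨m≡n 2≤d
... | inj₁ 3≤d  = contradiction fin
  (large⇒infinite d c (ℕ.<⇒≤ 2≤d) (s≤s (s≤s z≤n)) (expanding-degree≥3 d c 3≤d))
... | inj₂ refl = inj₂ (refl , refl)

-- Collisions of squares and returns to 0

residue-square : ∀ h x → ∃[ r ] r < suc h × x * x ≡ + r * + r [mod + suc (h ℕ.* 2) ]
residue-square h x = split (ℕ.≤-<-connex r h)
  where
  p = suc (h ℕ.* 2)
  r = x %ℕ p
  k = x /ℕ p

  x≡r : x ≡ + r [mod + p ]
  x≡r = mod (divides k (trans (cong (_- + r) (a≡a%ℕn+[a/ℕn]*n x p)) (cancel (+ r) (k * + p))))
    where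
    cancel : ∀ r y → (r + y) - r ≡ y
    cancel = solve-∀

  -- The residue of `- x`: when `r` exceeds `h`, `s` is at most `h` and has the same square modulo
  -- `p`.
  s = p ∸ r

  r+s≡p : + r + + s ≡ + p
  r+s≡p = cong +_ (ℕ.m+[n∸m]≡n (ℕ.<⇒≤ (n%ℕd<d x p)))

  s<suc-h : h < r → s < suc h
  s<suc-h h<r = ℕ.≤-<-trans (ℕ.∸-monoʳ-≤ p h<r)
    (s≤s (ℕ.≤-reflexive (trans (cong (_∸ h) (trans (ℕ.*-comm h 2) (cong (h ℕ.+_) (ℕ.+-identityʳ h))))
      (ℕ.m+n∸m≡n h h))))

  r²≡s² : + r * + r ≡ + s * + s [mod + p ]
  r²≡s² = mod (divides (+ r - + s) (trans (factor (+ r) (+ s)) (cong ((+ r - + s) *_) r+s≡p)))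
    where
    factor : ∀ r s → r * r - s * s ≡ (r - s) * (r + s)
    factor = solve-∀

  split : r ≤ h ⊎ h < r → ∃[ r ] r < suc h × x * x ≡ + r * + r [mod + p ]
  split (inj₁ r≤h) = r , s≤s r≤h , *-mod x≡r x≡r
  split (inj₂ h<r) = s , s<suc-h h<r , mod-trans (*-mod x≡r x≡r) r²≡s²

abstract
  -- Up to sign there are `h + 1` residues modulo `2h + 1`, so the pigeonhole principle applies to
  -- the `h + 2` values `w 0`, ..., `w (h + 1)`.
  square-collision : ∀ h (w : ℕ → ℤ) → ∃[ i ] ∃[ t ] 1 ≤ t × t ≤ suc h ×
                     w i * w i ≡ w (i ℕ.+ t) * w (i ℕ.+ t) [mod + suc (h ℕ.* 2) ]
  square-collision h w
    with i , j , i<j , fi≡fj ← Fin.pigeonhole (ℕ.n<1+n (suc h))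
           (λ i → fromℕ< (proj₁ (proj₂ (residue-square h (w (toℕ i))))))
    with t , eq ← ℕ.m≤n⇒∃[o]m+o≡n i<j
    = toℕ i , suc t , s≤s z≤n , t≤1+h , collision
    where
    i+t≡j : toℕ i ℕ.+ suc t ≡ toℕ j
    i+t≡j = trans (ℕ.+-suc (toℕ i) t) eq

    t≤1+h : suc t ≤ suc h
    t≤1+h = ℕ.≤-trans (ℕ.m≤n+m (suc t) (toℕ i))
      (subst (_≤ suc h) (sym i+t≡j) (ℕ.≤-pred (Fin.toℕ<n j)))

    r : (k : Fin (2 ℕ.+ h)) → ∃[ r ] r < suc h × w (toℕ k) * w (toℕ k) ≡ + r * + r [mod + suc (h ℕ.* 2) ]
    r k = residue-square h (w (toℕ k))

    ri≡rj : proj₁ (r i) ≡ proj₁ (r j)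
    ri≡rj = trans (sym (Fin.toℕ-fromℕ< (proj₁ (proj₂ (r i)))))
      (trans (cong toℕ fi≡fj) (Fin.toℕ-fromℕ< (proj₁ (proj₂ (r j)))))

    collision : w (toℕ i) * w (toℕ i) ≡ w (toℕ i ℕ.+ suc t) * w (toℕ i ℕ.+ suc t) [mod + suc (h ℕ.* 2) ]
    collision rewrite i+t≡j = mod-trans (proj₂ (proj₂ (r i)))
      (mod-trans (mod-reflexive (cong (λ k → + k * + k) ri≡rj)) (mod-sym (proj₂ (proj₂ (r j)))))

-- The zero at `suc n` makes 0 periodic modulo `m`. Carried forward `s` steps, the collision equates
-- the zero `W N` with `W (N + t)`, which is congruent to `W t`.
orbit-return : ∀ d c n i t → orbit d c (suc n) ≡ 0ℤ [mod m ] →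
               orbit d c (suc i) ≡ orbit d c (suc (i ℕ.+ t)) [mod m ] →
               orbit d c t ≡ 0ℤ [mod m ]
orbit-return {m} d c n i t Wn≡0 Wi≡Wi+t =
  mod-trans (mod-sym (orbit-+-mod d c N t WN≡0))
    (mod-trans (mod-reflexive shift)
      (mod-trans (iterate-mod d c s (mod-sym Wi≡Wi+t))
        (mod-trans (mod-reflexive (sym (iterate-+ (φ d c) 0ℤ (suc i) s))) WN≡0)))
  where
  -- Chosen so that `N` unfolds from `suc n * suc i`, a multiple of `suc n`.
  s = n ℕ.* suc i
  N = suc i ℕ.+ s

  WN≡0 : orbit d c N ≡ 0ℤ [mod m ]
  WN≡0 = orbit-∣ d c {k = suc n} (ℕ∣.m∣m*n (suc i)) Wn≡0

  shift : orbit d c (N ℕ.+ t) ≡ iterate (φ d c) (orbit d c (suc (i ℕ.+ t))) s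
  shift = trans (cong (orbit d c) (regroup i s t)) (iterate-+ (φ d c) 0ℤ (suc (i ℕ.+ t)) s)
    where
    regroup : ∀ i s t → suc i ℕ.+ s ℕ.+ t ≡ suc (i ℕ.+ t) ℕ.+ s
    regroup = ℕ-Solver.solve-∀

-- With 4 excluded the power of 2 in `n` is 1 or 2, and these are the indices at which `W` is known
-- explicitly.
odd-part : ∀ n → ¬ 4 ∣ n → ∃[ u ] ∃[ e ] n ≡ suc (u ℕ.* 2) ℕ.* e × (e ≡ 1 ⊎ e ≡ 2)
odd-part n 4∤n with even∨odd n
... | inj₂ (u , eq) = u , 1 , trans eq (sym (ℕ.*-identityʳ _)) , inj₁ refl
... | inj₁ (k , eq) with even∨odd k
...   | inj₂ (u , refl) = u , 2 , eq , inj₂ refl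
...   | inj₁ (l , refl) = contradiction (ℕ∣.divides l (trans eq (ℕ.*-assoc l 2 2))) 4∤n

-- Even degree with `c = 1`

module EvenDegree (q : ℕ) (1≤q : 1 ≤ q) where

  private
    d = q ℕ.* 2
    W = orbit d 1ℤ

    1≤d : 1 ≤ d
    1≤d = ℕ.≤-trans (s≤s z≤n) (ℕ.*-monoˡ-≤ 2 1≤q)

  φ-square : ∀ x y → x * x ≡ y * y [mod m ] → φ d 1ℤ x ≡ φ d 1ℤ y [mod m ]
  φ-square x y x²≡y² = +-mod (mod-trans (mod-reflexive (even-^ x q))
    (mod-trans (^-mod q x²≡y²) (mod-reflexive (sym (even-^ y q))))) mod-refl

  W-suc-square : ∀ i j → W i * W i ≡ W j * W j [mod m ] → W (suc i) ≡ W (suc j) [mod m ]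
  W-suc-square i j Wi²≡Wj² = mod-trans (mod-reflexive (iterate-suc (φ d 1ℤ) 0ℤ i))
    (mod-trans (φ-square (W i) (W j) Wi²≡Wj²) (mod-reflexive (sym (iterate-suc (φ d 1ℤ) 0ℤ j))))

  φ-one : φ d 1ℤ 1ℤ ≡ + 2
  φ-one = cong (_+ 1ℤ) (ℤ.^-zeroˡ d)

  W₁ : W 1 ≡ + 1
  W₁ = orbit-1 d 1ℤ 1≤d

  W₂ : W 2 ≡ + 2
  W₂ = trans (orbit-2 d 1ℤ 1≤d) φ-one

  mod-4 : ∀ x k → x ≡ + 1 [mod + 4 ] ⊎ x ≡ + 2 [mod + 4 ] →
          iterate (φ d 1ℤ) x k ≡ + 1 [mod + 4 ] ⊎ iterate (φ d 1ℤ) x k ≡ + 2 [mod + 4 ]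
  mod-4 x zero    p        = p
  mod-4 x (suc k) (inj₁ p) = mod-4 (φ d 1ℤ x) k (inj₂ (mod-trans (φ-mod d 1ℤ p) (mod-reflexive φ-one)))
  -- Modulo 4 the squares of 2 and 0 agree, so 2 has the same image as 0, namely 1.
  mod-4 x (suc k) (inj₂ p) = mod-4 (φ d 1ℤ x) k (inj₁ (mod-trans (φ-mod d 1ℤ p)
    (mod-trans (φ-square (+ 2) 0ℤ (mod (divides 1ℤ refl))) (mod-reflexive (φ-zero 1ℤ 1≤d)))))

  4∤W : ∀ n → ¬ W (suc n) ≡ 0ℤ [mod + 4 ]
  4∤W n 4∣W with mod-4 (W 1) n (inj₁ (mod-reflexive W₁))
  ... | inj₁ p = contradiction (ℕ∣.∣⇒≤ (∣⇒∣ᵤ (mod⇒∣ (mod-trans (mod-sym p) 4∣W)))) λ { (s≤s ()) }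
  ... | inj₂ p = contradiction (ℕ∣.∣⇒≤ (∣⇒∣ᵤ (mod⇒∣ (mod-trans (mod-sym p) 4∣W)))) λ { (s≤s (s≤s ())) }

  module _ (n : ℕ) (Wn≡0 : W (suc n) ≡ 0ℤ [mod + suc n ]) where

    4∤n : ¬ 4 ∣ suc n
    4∤n 4∣n = 4∤W n (mod-∣ 4∣n Wn≡0)

    small-return : ∀ h → W (suc n) ≡ 0ℤ [mod + suc (h ℕ.* 2) ] →
                   ∃[ t ] 1 ≤ t × t ≤ suc h × W t ≡ 0ℤ [mod + suc (h ℕ.* 2) ]
    small-return h Wn≡0[p] with i , t , 1≤t , t≤1+h , Wi²≡Wj² ← square-collision h W =
      t , 1≤t , t≤1+h , orbit-return d 1ℤ n i t Wn≡0[p] (W-suc-square i (i ℕ.+ t) Wi²≡Wj²)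

    -- The return time `t` need not divide `suc n`; a common divisor of both keeps the bound and the
    -- zero.
    small-divisor : ∀ h → suc (h ℕ.* 2) ∣ suc n →
                    ∃[ g ] g ≤ suc h × g ∣ suc n × W g ≡ 0ℤ [mod + suc (h ℕ.* 2) ]
    small-divisor h p∣n
      with t , 1≤t , t≤1+h , Wt≡0 ← small-return h (mod-∣ p∣n Wn≡0)
      with g , g∣t , g∣n , Wg≡0 ← orbit-common-divisor d 1ℤ t (suc n) Wt≡0 (mod-∣ p∣n Wn≡0)
      = g , ℕ.≤-trans (ℕ∣.∣⇒≤ {{ℕ.>-nonZero 1≤t}} g∣t) t≤1+h , g∣n , Wg≡0

    odd-divisor : ∀ h → suc (h ℕ.* 2) ∣ suc n → h ≡ 0
    odd-divisor = <-rec _ step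
      where
      half-< : ∀ u e h → 1 ≤ h → e ≡ 1 ⊎ e ≡ 2 → suc (u ℕ.* 2) ℕ.* e ≤ suc h → u < h
      half-< u e h 1≤h e≡1∨2 ue≤1+h = ℕ.*-cancelʳ-< 2 u h (begin-strict
        u ℕ.* 2 ≤⟨ ℕ.≤-pred (ℕ.≤-trans (ℕ.m≤m*n (suc (u ℕ.* 2)) e {{e≢0 e≡1∨2}}) ue≤1+h) ⟩
        h       <⟨ ℕ.m<m*n h 2 {{ℕ.>-nonZero 1≤h}} (s≤s (s≤s z≤n)) ⟩
        h ℕ.* 2 ∎)
        where
        open ℕ.≤-Reasoning
        e≢0 : ∀ {e} → e ≡ 1 ⊎ e ≡ 2 → ℕ.NonZero e
        e≢0 (inj₁ refl) = _
        e≢0 (inj₂ refl) = _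

      -- A modulus of at least 3 exceeds both `W 1 = 1` and `W 2 = 2`.
      p∤W : ∀ {h e} → e ≡ 1 ⊎ e ≡ 2 → ¬ W e ≡ 0ℤ [mod + (3 ℕ.+ h) ]
      p∤W (inj₁ refl) p∣W = contradiction
        (ℕ∣.∣⇒≤ (∣⇒∣ᵤ (mod⇒∣ (mod-trans (mod-reflexive (sym W₁)) p∣W)))) λ { (s≤s ()) }
      p∤W (inj₂ refl) p∣W = contradiction
        (ℕ∣.∣⇒≤ (∣⇒∣ᵤ (mod⇒∣ (mod-trans (mod-reflexive (sym W₂)) p∣W)))) λ { (s≤s (s≤s ())) }

      step : ∀ h → (∀ {u} → u < h → suc (u ℕ.* 2) ∣ suc n → u ≡ 0) → suc (h ℕ.* 2) ∣ suc n → h ≡ 0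
      step zero    _       _   = refl
      step (suc h) smaller p∣n
        with g , g≤2+h , g∣n , Wg≡0 ← small-divisor (suc h) p∣n
        with u , e , refl , e≡1∨2 ← odd-part g (λ 4∣g → 4∤n (ℕ∣.∣-trans 4∣g g∣n))
        -- From `2u + 1 ≤ g ≤ h + 2` follows `u < h + 1`, so induction gives `u = 0`, leaving
        -- `g = e`.
        with refl ← smaller (half-< u e (suc h) (s≤s z≤n) e≡1∨2 g≤2+h) (ℕ∣.∣-trans (ℕ∣.m∣m*n e) g∣n)
        = contradiction (subst (λ k → W k ≡ 0ℤ [mod + (3 ℕ.+ h ℕ.* 2) ]) (ℕ.*-identityˡ e) Wg≡0)
            (p∤W e≡1∨2)

    n≡1∨2 : suc n ≡ 1 ⊎ suc n ≡ 2
    n≡1∨2 with u , e , n≡ue , e≡1∨2 ← odd-part (suc n) 4∤n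
          with refl ← odd-divisor u (subst (suc (u ℕ.* 2) ∣_) (sym n≡ue) (ℕ∣.m∣m*n e))
          with e≡1∨2
    ... | inj₁ refl = inj₁ n≡ue
    ... | inj₂ refl = inj₂ n≡ue

  D≐1∨2 : D d 1ℤ ≐ (｛ 1 ｝ ∪ ｛ 2 ｝)
  D≐1∨2 = D⊆ , λ { (inj₁ refl) → 1∈D d 1ℤ
                 ; (inj₂ refl) → mod⇒D d 1ℤ (s≤s z≤n)
                     (mod-trans (mod-reflexive W₂) (mod (divides 1ℤ refl))) }
    where
    D⊆ : D d 1ℤ ⊆ (｛ 1 ｝ ∪ ｛ 2 ｝)
    D⊆ {suc n} n∈D with n≡1∨2 n (D⇒mod d 1ℤ n∈D)
    ... | inj₁ eq = inj₁ (sym eq)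
    ... | inj₂ eq = inj₂ (sym eq)

-- The polynomial `x² - 2` and the conclusion

D[x²-2]≐1∨2 : D 2 (- (+ 2)) ≐ (｛ 1 ｝ ∪ ｛ 2 ｝)
D[x²-2]≐1∨2 = D⊆ , λ { (inj₁ refl) → 1∈D 2 (- (+ 2)) ; (inj₂ refl) → s≤s z≤n , ℕ∣.∣-refl }
  where
  -- The orbit is 0, -2, 2, 2, ..., so an `n ≥ 3` in `D` would divide 2.
  2-fixed : ∀ k → iterate (φ 2 (- (+ 2))) (+ 2) k ≡ + 2
  2-fixed zero    = refl
  2-fixed (suc k) = 2-fixed k

  D⊆ : D 2 (- (+ 2)) ⊆ (｛ 1 ｝ ∪ ｛ 2 ｝)
  D⊆ {1} _ = inj₁ refl
  D⊆ {2} _ = inj₂ refl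
  D⊆ {suc (suc (suc n))} (_ , n∣W) = contradiction
    (ℕ∣.∣⇒≤ (subst (λ w → 3 ℕ.+ n ∣ ∣ w ∣) (2-fixed (suc n)) n∣W)) λ { (s≤s (s≤s ())) }

exceptional⇒≐ : ∀ d c → 2 ≤ d → Exceptional d c → D d c ≐ (｛ 1 ｝ ∪ ｛ 2 ｝)
exceptional⇒≐ _ _ 2≤d (inj₁ (ℕ∣.divides (suc q) refl , refl)) = EvenDegree.D≐1∨2 (suc q) (s≤s z≤n)
exceptional⇒≐ _ _ () (inj₁ (ℕ∣.divides zero refl , refl))
exceptional⇒≐ _ _ _ (inj₂ (refl , refl)) = D[x²-2]≐1∨2

≐⇒finite : ∀ {P : Pred ℕ 0ℓ} → P ≐ (｛ 1 ｝ ∪ ｛ 2 ｝) → Finite P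
≐⇒finite {P} (P⊆ , ⊆P) = 1 ∷ 2 ∷ [] , P⊆xs , λ
  { (here refl)         → ⊆P (inj₁ refl)
  ; (there (here refl)) → ⊆P (inj₂ refl) }
  where
  P⊆xs : P ⊆ (_∈ 1 ∷ 2 ∷ [])
  P⊆xs Px with P⊆ Px
  ... | inj₁ refl = here refl
  ... | inj₂ refl = there (here refl)

theorem3p3 : (d : ℕ) (c : ℤ) → 2 ≤ d →
    (Finite (D d c) ⇔ ((2 ∣ d × c ≡ + 1) ⊎ (d ≡ 2 × c ≡ - (+ 2))))
    × (Finite (D d c) → D d c ≐ (｛ 1 ｝ ∪ ｛ 2 ｝))
theorem3p3 d c 2≤d =
  mk⇔ finite⇒ (λ exceptional → ≐⇒finite (exceptional⇒≐ d c 2≤d exceptional))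
  , λ fin → exceptional⇒≐ d c 2≤d (finite⇒ fin)
  where
  finite⇒ = finite⇒exceptional d c 2≤d
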